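{- Let $k \ge 5$ be a natural number, and consider the problem GEP-UW on the known undirected ladder graph $G_{2,4}$ with start vertex $s_0=(1,1)$ and with all edge weights in $\{1,k\}$. The strict competitive ratio of any deterministic online algorithm $\textsc{alg}$ for this problem is bounded from below by $\frac{5}{4}$; that is, if $\textsc{alg}$ is a deterministic online algorithm and $r$ is a real number such that $\mathrm{cost}_{\textsc{alg}}(c) \le r\cdot \mathrm{cost}_{\textsc{opt}}(c)$ for every weight function $c : E(G_{2,4}) \to \{1,k\}$, then $r \ge \frac54$.
   Context: For $m,n\ge 1$, the undirected $m\times n$ grid $G_{m,n}=(V,E)$ has $V=\{(i,j) : 1\le i\le m,\ 1\le j\le n\}$ and edges $\{(i,j),(i+1,j)\}$ for $1\le i\le m-1$, $1\le j\le n$, and $\{(i,j),(i,j+1)\}$ for $1\le i\le m$, $1\le j\le n-1$. The grids $G_{2,n}$ are called ladders. A path is a sequence of vertices in which consecutive vertices are adjacent; vertices (and edges) may be repeated. The cost of a path $v_1,\dots,v_\ell$ under a weight function $c$ is $\sum_{i=1}^{\ell-1} c(\{v_i,v_{i+1}\})$. GEP-UW (graph exploration problem in a known undirected graph structure with unknown edge weights): an agent starts in $s_0$ and must travel along a path that visits every vertex of the graph at least once (it need not return to $s_0$ and may end anywhere), minimizing the cost of the path. In each time step it moves from its current vertex to a neighboring vertex. The agent knows the unweighted graph, $s_0$ and the set of admissible weights from the beginning, but it does not know the weight function $c$. When it is in a vertex for the first time (in particular in $s_0$ at the beginning), the weights of all edges incident to that vertex are revealed. The agent has unlimited memory and computing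 power. A deterministic online algorithm determines each next move as a function of the information revealed so far (the graph, the path traveled so far, and the weights of all edges incident to visited vertices). $\mathrm{cost}_{\textsc{alg}}(c)$ is the cost of the path traveled by the agent under $\textsc{alg}$ when the weight function is $c$, and $\mathrm{cost}_{\textsc{opt}}(c)$ is the minimum cost of a path starting in $s_0$ that visits all vertices (computed with full knowledge of $c$). -}

module Defs where

open import Data.Fin.Base using (Fin; zero; suc; inject₁)
import Data.Fin.Properties as Fin
import Data.Integer.Base as ℤ
open import Data.List.Base
  using (List; []; _∷_; _++_; map; filter; allFin; cartesianProductWith)
open import Data.List.Membership.Propositional using (_∈_)
open import Data.List.Membership.Propositional.Properties
  using (∈-++⁺ˡ; ∈-++⁺ʳ; ∈-allFin; ∈-cartesianProductWith⁺)
import Data.List.Membership.DecPropositional as DecMembership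
open import Data.Maybe.Base using (Maybe; just; nothing)
open import Data.Nat.Base using (ℕ; zero; suc; _⊔_)
import Data.Nat.Base as ℕ
import Data.Nat.Properties as ℕ
open import Data.Product.Base using (Σ; ∃; ∃₂; _×_; _,_; proj₁; proj₂)
open import Data.Product.Properties using (≡-dec)
open import Data.Rational.Base using (ℚ; 0ℚ; 1ℚ; ∣_∣; Positive; positive; _/_; 1/_)
import Data.Rational.Base as ℚ
import Data.Rational.Properties as ℚ
import Data.Rational.Solver as ℚSolver
open import Data.Sum.Base using (_⊎_)
open import Relation.Binary.Definitions using (DecidableEquality)
open import Relation.Binary.PropositionalEquality
  using (_≡_; refl; sym; trans; cong; cong₂; subst)
open import Relation.Nullary.Decidable using (_⊎-dec_)

IsCauchy : (ℕ → ℚ) → Set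
IsCauchy x = ∀ ε → 0ℚ ℚ.< ε →
  ∃ λ N → ∀ m n → N ℕ.≤ m → N ℕ.≤ n → ∣ x m ℚ.- x n ∣ ℚ.≤ ε

record ℝ : Set where
  constructor mkℝ
  field
    seq    : ℕ → ℚ
    cauchy : IsCauchy seq

open ℝ public

infix 4 _≤ʳ_

_≤ʳ_ : ℝ → ℝ → Set
x ≤ʳ y = ∀ ε → 0ℚ ℚ.< ε →
  ∃ λ N → ∀ n → N ℕ.≤ n → seq x n ℚ.≤ seq y n ℚ.+ ε

fromℚ : ℚ → ℝ
fromℚ q = mkℝ (λ _ → q) λ ε 0<ε → 0 , λ _ _ _ _ →
  subst (ℚ._≤ ε) (sym (cong ∣_∣ (ℚ.+-inverseʳ q))) (ℚ.<⇒≤ 0<ε)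

fromℕ : ℕ → ℝ
fromℕ n = fromℚ (ℤ.+ n / 1)

private
  bounded : ∀ {x} → IsCauchy x →
    ∃₂ λ B N → Positive B × (∀ n → N ℕ.≤ n → ∣ x n ∣ ℚ.≤ B)
  bounded {x} x-cauchy with x-cauchy 1ℚ (ℚ.positive⁻¹ 1ℚ)
  ... | N , close = 1ℚ ℚ.+ ∣ x N ∣ , N
      , ℚ.pos+nonNeg⇒pos 1ℚ ∣ x N ∣ {{ℚ.nonNegative (ℚ.0≤∣p∣ (x N))}}
      , λ n N≤n → begin
          ∣ x n ∣                        ≡⟨ cong ∣_∣ (split (x n) (x N)) ⟩
          ∣ (x n ℚ.- x N) ℚ.+ x N ∣      ≤⟨ ℚ.∣p+q∣≤∣p∣+∣q∣ (x n ℚ.- x N) (x N) ⟩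
          ∣ x n ℚ.- x N ∣ ℚ.+ ∣ x N ∣    ≤⟨ ℚ.+-monoˡ-≤ ∣ x N ∣ (close n N N≤n ℕ.≤-refl) ⟩
          1ℚ ℚ.+ ∣ x N ∣                 ∎
    where
    open ℚ.≤-Reasoning
    open ℚSolver.+-*-Solver
    split : ∀ p q → p ≡ (p ℚ.- q) ℚ.+ q
    split = solve 2 (λ p q → p := (p :- q) :+ q) refl

  *-mono-≤-abs : ∀ p q {a b} → ∣ p ∣ ℚ.≤ a → ∣ q ∣ ℚ.≤ b → ∣ p ℚ.* q ∣ ℚ.≤ a ℚ.* b
  *-mono-≤-abs p q {a} {b} ∣p∣≤a ∣q∣≤b = begin
    ∣ p ℚ.* q ∣      ≡⟨ ℚ.∣p*q∣≡∣p∣*∣q∣ p q ⟩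
    ∣ p ∣ ℚ.* ∣ q ∣  ≤⟨ ℚ.*-monoʳ-≤-nonNeg ∣ q ∣ {{ℚ.nonNegative (ℚ.0≤∣p∣ q)}} ∣p∣≤a ⟩
    a ℚ.* ∣ q ∣      ≤⟨ ℚ.*-monoˡ-≤-nonNeg a {{ℚ.nonNegative (ℚ.≤-trans (ℚ.0≤∣p∣ p) ∣p∣≤a)}} ∣q∣≤b ⟩
    a ℚ.* b          ∎
    where open ℚ.≤-Reasoning

  divide : ∀ ε B → 0ℚ ℚ.< ε → Positive B → ∃ λ δ → 0ℚ ℚ.< δ × δ ℚ.* B ≡ ε
  divide ε B 0<ε B>0 = ε ℚ.* B⁻¹
    , ℚ.positive⁻¹ (ε ℚ.* B⁻¹)
        {{ℚ.pos*pos⇒pos ε {{positive 0<ε}} B⁻¹ {{ℚ.1/pos⇒pos B {{B>0}}}}}}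
    , trans (ℚ.*-assoc ε B⁻¹ B)
        (trans (cong (ε ℚ.*_) (ℚ.*-inverseˡ B {{B≢0}})) (ℚ.*-identityʳ ε))
    where
    B≢0 = ℚ.pos⇒nonZero B {{B>0}}
    B⁻¹ : ℚ
    B⁻¹ = (1/ B) {{B≢0}}

  expand : ∀ a b c d →
    a ℚ.* b ℚ.- c ℚ.* d ≡ a ℚ.* (b ℚ.- d) ℚ.+ (a ℚ.- c) ℚ.* d
  expand = solve 4 (λ a b c d →
    a :* b :- c :* d := a :* (b :- d) :+ (a :- c) :* d) refl
    where open ℚSolver.+-*-Solver

  collect : ∀ a b d → a ℚ.* d ℚ.+ d ℚ.* b ≡ d ℚ.* (a ℚ.+ b)
  collect = solve 3 (λ a b d → a :* d :+ d :* b := d :* (a :+ b)) refl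
    where open ℚSolver.+-*-Solver

  product-close : (x y : ℕ → ℚ) (A B δ ε : ℚ) (K L P Q : ℕ) →
    (∀ n → K ℕ.≤ n → ∣ x n ∣ ℚ.≤ A) →
    (∀ n → L ℕ.≤ n → ∣ y n ∣ ℚ.≤ B) →
    (∀ m n → P ℕ.≤ m → P ℕ.≤ n → ∣ x m ℚ.- x n ∣ ℚ.≤ δ) →
    (∀ m n → Q ℕ.≤ m → Q ℕ.≤ n → ∣ y m ℚ.- y n ∣ ℚ.≤ δ) →
    δ ℚ.* (A ℚ.+ B) ≡ ε →
    ∃ λ N → ∀ m n → N ℕ.≤ m → N ℕ.≤ n →
      ∣ x m ℚ.* y m ℚ.- x n ℚ.* y n ∣ ℚ.≤ ε
  product-close x y A B δ ε K L P Q ∣x∣≤A ∣y∣≤B x-close y-close δ*[A+B]≡ε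
    = K ⊔ L ⊔ (P ⊔ Q) , λ m n N≤m N≤n → begin
        ∣ x m ℚ.* y m ℚ.- x n ℚ.* y n ∣
          ≡⟨ cong ∣_∣ (expand (x m) (y m) (x n) (y n)) ⟩
        ∣ x m ℚ.* (y m ℚ.- y n) ℚ.+ (x m ℚ.- x n) ℚ.* y n ∣
          ≤⟨ ℚ.∣p+q∣≤∣p∣+∣q∣ (x m ℚ.* (y m ℚ.- y n)) ((x m ℚ.- x n) ℚ.* y n) ⟩
        ∣ x m ℚ.* (y m ℚ.- y n) ∣ ℚ.+ ∣ (x m ℚ.- x n) ℚ.* y n ∣
          ≤⟨ ℚ.+-mono-≤
               (*-mono-≤-abs (x m) (y m ℚ.- y n) (∣x∣≤A m (K≤ N≤m))
                 (y-close m n (Q≤ N≤m) (Q≤ N≤n)))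
               (*-mono-≤-abs (x m ℚ.- x n) (y n)
                 (x-close m n (P≤ N≤m) (P≤ N≤n)) (∣y∣≤B n (L≤ N≤n))) ⟩
        A ℚ.* δ ℚ.+ δ ℚ.* B
          ≡⟨ collect A B δ ⟩
        δ ℚ.* (A ℚ.+ B)
          ≡⟨ δ*[A+B]≡ε ⟩
        ε ∎
    where
    open ℚ.≤-Reasoning
    K≤ : ∀ {n} → K ⊔ L ⊔ (P ⊔ Q) ℕ.≤ n → K ℕ.≤ n
    K≤ h = ℕ.m⊔n≤o⇒m≤o K L (ℕ.m⊔n≤o⇒m≤o (K ⊔ L) (P ⊔ Q) h)
    L≤ : ∀ {n} → K ⊔ L ⊔ (P ⊔ Q) ℕ.≤ n → L ℕ.≤ n
    L≤ h = ℕ.m⊔n≤o⇒n≤o K L (ℕ.m⊔n≤o⇒m≤o (K ⊔ L) (P ⊔ Q) h)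
    P≤ : ∀ {n} → K ⊔ L ⊔ (P ⊔ Q) ℕ.≤ n → P ℕ.≤ n
    P≤ h = ℕ.m⊔n≤o⇒m≤o P Q (ℕ.m⊔n≤o⇒n≤o (K ⊔ L) (P ⊔ Q) h)
    Q≤ : ∀ {n} → K ⊔ L ⊔ (P ⊔ Q) ℕ.≤ n → Q ℕ.≤ n
    Q≤ h = ℕ.m⊔n≤o⇒n≤o P Q (ℕ.m⊔n≤o⇒n≤o (K ⊔ L) (P ⊔ Q) h)

  *-cauchy : ∀ {x y} → IsCauchy x → IsCauchy y → IsCauchy (λ n → x n ℚ.* y n)
  *-cauchy {x} {y} x-cauchy y-cauchy ε 0<ε =
    let A , K , A>0 , ∣x∣≤A = bounded {x} x-cauchy
        B , L , B>0 , ∣y∣≤B = bounded {y} y-cauchy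
        δ , 0<δ , δ*[A+B]≡ε =
          divide ε (A ℚ.+ B) 0<ε (ℚ.pos+pos⇒pos A {{A>0}} B {{B>0}})
        P , x-close = x-cauchy δ 0<δ
        Q , y-close = y-cauchy δ 0<δ
    in product-close x y A B δ ε K L P Q
         ∣x∣≤A ∣y∣≤B x-close y-close δ*[A+B]≡ε

infixl 7 _*ʳ_

_*ʳ_ : ℝ → ℝ → ℝ
x *ʳ y = mkℝ (λ n → seq x n ℚ.* seq y n) (*-cauchy {seq x} {seq y} (cauchy x) (cauchy y))

-- The order of the two endpoints carries no meaning; see `Joins`.
record Graph : Set₁ where
  field
    Vertex    : Set
    Edge      : Set
    endpoints : Edge → Vertex × Vertex
    _≟_       : DecidableEquality Vertex
    edges     : List Edge
    complete  : ∀ e → e ∈ edges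

  Joins : Edge → Vertex → Vertex → Set
  Joins e u v = endpoints e ≡ (u , v) ⊎ endpoints e ≡ (v , u)

  Move : Vertex → Set
  Move u = Σ Vertex λ v → Σ Edge λ e → Joins e u v

-- Rows and columns are numbered from 0.  `vertical i j` joins (i , j) to
-- (i + 1 , j), and `horizontal i j` joins (i , j) to (i , j + 1).
data GridEdge : ℕ → ℕ → Set where
  vertical   : ∀ {m n} → Fin m → Fin n → GridEdge (suc m) n
  horizontal : ∀ {m n} → Fin m → Fin n → GridEdge m (suc n)

gridEndpoints : ∀ {m n} → GridEdge m n → (Fin m × Fin n) × (Fin m × Fin n)
gridEndpoints (vertical i j)   = (inject₁ i , j) , (suc i , j)
gridEndpoints (horizontal i j) = (i , inject₁ j) , (i , suc j)

verticals : ∀ m n → List (GridEdge m n)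
verticals zero    n = []
verticals (suc m) n = cartesianProductWith vertical (allFin m) (allFin n)

horizontals : ∀ m n → List (GridEdge m n)
horizontals m zero    = []
horizontals m (suc n) = cartesianProductWith horizontal (allFin m) (allFin n)

gridEdges : ∀ m n → List (GridEdge m n)
gridEdges m n = verticals m n ++ horizontals m n

gridEdges-complete : ∀ {m n} (e : GridEdge m n) → e ∈ gridEdges m n
gridEdges-complete (vertical i j) =
  ∈-++⁺ˡ (∈-cartesianProductWith⁺ vertical (∈-allFin i) (∈-allFin j))
gridEdges-complete {m} {suc n} (horizontal i j) =
  ∈-++⁺ʳ (verticals m (suc n))
    (∈-cartesianProductWith⁺ horizontal (∈-allFin i) (∈-allFin j))

grid : ℕ → ℕ → Graph
grid m n = record
  { Vertex    = Fin m × Fin n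
  ; Edge      = GridEdge m n
  ; endpoints = gridEndpoints
  ; _≟_       = ≡-dec Fin._≟_ Fin._≟_
  ; edges     = gridEdges m n
  ; complete  = gridEdges-complete
  }

-- G, s₀ and the list W of admissible weights are known to the agent; the
-- weight function is not.
module Exploration (G : Graph) (s₀ : Graph.Vertex G) (W : List ℕ) where

  open Graph G
  open DecMembership _≟_ using (_∈?_)

  infixl 5 _▸_

  data Path : Vertex → Set where
    start : Path s₀
    _▸_   : ∀ {u} → Path u → ((v , _) : Move u) → Path v

  visited : ∀ {v} → Path v → List Vertex
  visited {v} start   = v ∷ []
  visited {v} (p ▸ _) = v ∷ visited p

  Explores : ∀ {v} → Path v → Set
  Explores p = ∀ u → u ∈ visited p

  WeightFunction : Set
  WeightFunction = Σ (Edge → ℕ) λ c → ∀ e → c e ∈ W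

  weight : WeightFunction → Edge → ℕ
  weight = proj₁

  cost : WeightFunction → ∀ {v} → Path v → ℕ
  cost c start             = 0
  cost c (p ▸ (_ , e , _)) = cost c p ℕ.+ weight c e

  -- The edges incident to a visited vertex, with their weights.  This is a
  -- list rather than a function on edges so that a strategy sees first-order
  -- data: two weight functions agreeing on these edges reveal equal lists.
  revealed : WeightFunction → ∀ {v} → Path v → List (Edge × ℕ)
  revealed c p = map (λ e → e , weight c e) (filter incident? edges)
    where
    incident? = λ e → let (u , v) = endpoints e in
      (u ∈? visited p) ⊎-dec (v ∈? visited p)

  -- `nothing` means that the agent stops.
  Strategy : Set
  Strategy = ∀ {v} → Path v → List (Edge × ℕ) → Maybe (Move v)

  data Reaches (σ : Strategy) (c : WeightFunction) : ∀ {v} → Path v → Set where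
    start : Reaches σ c start
    step  : ∀ {v} {p : Path v} {move : Move v} → Reaches σ c p →
            σ p (revealed c p) ≡ just move → Reaches σ c (p ▸ move)

  Travels : Strategy → WeightFunction → ∀ {v} → Path v → Set
  Travels σ c p = Reaches σ c p × σ p (revealed c p) ≡ nothing

  -- The agent need not stop as soon as every vertex has been visited.
  record OnlineAlgorithm : Set where
    field
      strategy : Strategy
      solves   : ∀ c → ∃₂ λ v (p : Path v) → Travels strategy c p × Explores p

  -- By determinism, independent of the choice of path in `solves`.
  cost-alg : OnlineAlgorithm → WeightFunction → ℕ
  cost-alg alg c = cost c (proj₁ (proj₂ (OnlineAlgorithm.solves alg c)))

  IsCostOpt : WeightFunction → ℕ → Set
  IsCostOpt c m =
      (∃₂ λ v (p : Path v) → Explores p × cost c p ≡ m)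
    × (∀ {v} (p : Path v) → Explores p → m ℕ.≤ cost c p)

  StrictlyCompetitive : OnlineAlgorithm → ℝ → Set
  StrictlyCompetitive alg r = ∀ c opt → IsCostOpt c opt →
    fromℕ (cost-alg alg c) ≤ʳ r *ʳ fromℕ opt

{-# OPTIONS --safe #-}

-- Let the heavy edges be (0,0)-(0,1), (1,2)-(1,3) and either (0,1)-(0,2) or
-- (0,2)-(1,2).  In both cases the light edges form a spanning tree: a stem from
-- the start to the hub (1,1), where it branches into a leaf and an arm of four
-- vertices.  The leaf is (0,1) in the first case and (1,2) in the second, and
-- an agent that has seen neither of these vertices (nor (0,2)) cannot tell
-- which.  Visiting the leaf first costs 8, while visiting the arm first, or using
-- a heavy edge, costs at least 10.

module Submission where

open import Defs
open import Data.Bool.Base using (Bool; true; false; if_then_else_)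
import Data.Bool.Properties as Bool
open import Data.Fin.Base using (Fin; zero)
open import Data.Fin.Patterns using (0F; 1F; 2F; 3F)
import Data.Fin.Properties as Fin
open import Data.Integer.Base using (+_; -[1+_]; +≤+)
import Data.Integer.Base as ℤ
import Data.Integer.Properties as ℤ
open import Data.List.Base using (List; []; _∷_)
import Data.List.Membership.DecPropositional as DecMembership
open import Data.List.Membership.Propositional using (_∈_)
open import Data.List.Membership.Propositional.Properties using (∈-filter⁻)
open import Data.List.Properties using (map-cong-local)
import Data.List.Relation.Unary.All as All
open import Data.List.Relation.Unary.Any using (here; there)
open import Data.Maybe.Base using (just)
open import Data.Maybe.Properties using (just-injective)
open import Data.Nat.Base using (ℕ; zero; suc; _+_; _*_; _∸_; _⊔_; _≤_; _<_; s≤s; z≤n)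
open import Data.Nat.Induction using (<-rec)
import Data.Nat.Properties as ℕ
open import Data.Product.Base using (∃; ∃₂; _×_; _,_; proj₁; proj₂)
open import Data.Rational.Base using (0ℚ; ½; _/_)
import Data.Rational.Base as ℚ
import Data.Rational.Properties as ℚ
import Data.Rational.Solver as ℚSolver
import Data.Rational.Unnormalised.Base as ℚᵘ
import Data.Rational.Unnormalised.Properties as ℚᵘ
open import Data.Sum.Base using (_⊎_; inj₁; inj₂)
open import Relation.Binary.PropositionalEquality
  using (_≡_; refl; sym; trans; cong; subst; subst₂)
open import Relation.Nullary.Decidable
  using (Dec; map′; from-yes; decidable-stable; ¬?; _→-dec_; _×-dec_; _⊎-dec_)
open import Relation.Nullary.Negation using (¬_; contradiction)

-- Least natural numbers and inequalities between Cauchy reals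

¬¬-least : {P : ℕ → Set} → ∀ n → P n → ¬ ¬ (∃ λ m → P m × (∀ i → P i → m ≤ i))
¬¬-least {P} n Pn none = <-rec (λ n → ¬ P n)
  -- Strong induction refutes every `n`: one satisfying `P` with none below it would be least.
  (λ n ih Pn → none (n , Pn , λ i Pi → ℕ.≮⇒≥ λ i<n → ih i<n Pi)) n Pn

½ε+½ε : ∀ q ε → q ℚ.+ ½ ℚ.* ε ℚ.+ ½ ℚ.* ε ≡ q ℚ.+ ε
½ε+½ε = solve 2 (λ q ε → q :+ con ½ :* ε :+ con ½ :* ε := q :+ ε) refl
  where open ℚSolver.+-*-Solver

p≤q+∣p-q∣ : ∀ p q → p ℚ.≤ q ℚ.+ ℚ.∣ p ℚ.- q ∣
p≤q+∣p-q∣ p q = subst (ℚ._≤ q ℚ.+ ℚ.∣ p ℚ.- q ∣)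
  (solve 2 (λ p q → q :+ (p :- q) := p) refl p q)
  (ℚ.+-monoʳ-≤ q (p≤∣p∣ (p ℚ.- q)))
  where
  open ℚSolver.+-*-Solver
  p≤∣p∣ : ∀ p → p ℚ.≤ ℚ.∣ p ∣
  p≤∣p∣ (ℚ.mkℚ (+ _) _ _)      = ℚ.≤-refl
  p≤∣p∣ p@(ℚ.mkℚ -[1+ _ ] _ _) = ℚ.≤-trans (ℚ.nonPositive⁻¹ p) (ℚ.0≤∣p∣ p)

-- The index `N` comes from the modulus of `y` alone, so the doubly negated hypothesis serves only a
-- decidable comparison at each `n`. There, a far term of `y` lies within `½ ℚ.* ε` of the `n`-th.
fromℚ-≤ʳ-stable : ∀ q y → ¬ ¬ (fromℚ q ≤ʳ y) → fromℚ q ≤ʳ y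
fromℚ-≤ʳ-stable q y ¬¬q≤y ε 0<ε =
  N , λ n N≤n → decidable-stable (q ℚ.≤? seq y n ℚ.+ ε) λ q≰ →
    ¬¬q≤y λ q≤y → q≰ (bound n N≤n (q≤y (½ ℚ.* ε) 0<½ε))
  where
  0<½ε : 0ℚ ℚ.< ½ ℚ.* ε
  0<½ε = ℚ.positive⁻¹ (½ ℚ.* ε) {{ℚ.pos*pos⇒pos ½ ε {{ℚ.positive 0<ε}}}}
  N : ℕ
  N = proj₁ (cauchy y (½ ℚ.* ε) 0<½ε)
  bound : ∀ n → N ≤ n → (∃ λ M → ∀ m → M ≤ m → q ℚ.≤ seq y m ℚ.+ ½ ℚ.* ε) →
          q ℚ.≤ seq y n ℚ.+ ε
  bound n N≤n (M , q≤) = begin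
    q                                         ≤⟨ q≤ m (ℕ.m≤m⊔n M N) ⟩
    seq y m ℚ.+ ½ ℚ.* ε
      ≤⟨ ℚ.+-monoˡ-≤ (½ ℚ.* ε) (p≤q+∣p-q∣ (seq y m) (seq y n)) ⟩
    seq y n ℚ.+ ℚ.∣ seq y m ℚ.- seq y n ∣ ℚ.+ ½ ℚ.* ε
      ≤⟨ ℚ.+-monoˡ-≤ (½ ℚ.* ε) (ℚ.+-monoʳ-≤ (seq y n)
           (proj₂ (cauchy y (½ ℚ.* ε) 0<½ε) m n (ℕ.m≤n⊔m M N) N≤n)) ⟩
    seq y n ℚ.+ ½ ℚ.* ε ℚ.+ ½ ℚ.* ε           ≡⟨ ½ε+½ε (seq y n) ε ⟩
    seq y n ℚ.+ ε                             ∎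
    where
    open ℚ.≤-Reasoning
    m = M ⊔ N

ratio-bound : ∀ a o r → 0 < o → 5 * o ≤ 4 * a →
              fromℕ a ≤ʳ r *ʳ fromℕ o → fromℚ (+ 5 / 4) ≤ʳ r
ratio-bound a o@(suc _) r _ 5o≤4a a≤ro ε 0<ε =
  -- The tolerance is scaled by `O` so that cancelling `O` leaves exactly `ε`.
  let (N , a≤) = a≤ro (ε ℚ.* O)
        (ℚ.positive⁻¹ (ε ℚ.* O) {{ℚ.pos*pos⇒pos ε {{ℚ.positive 0<ε}} O {{O>0}}}})
  in N , λ n N≤n → ℚ.*-cancelʳ-≤-pos O {{O>0}} (begin
    (+ 5 / 4) ℚ.* O              ≤⟨ 5/4*O≤a ⟩
    + a / 1                      ≤⟨ a≤ n N≤n ⟩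
    seq r n ℚ.* O ℚ.+ ε ℚ.* O    ≡⟨ ℚ.*-distribʳ-+ O (seq r n) ε ⟨
    (seq r n ℚ.+ ε) ℚ.* O        ∎)
  where
  open ℚ.≤-Reasoning
  O = + o / 1
  O>0 : ℚ.Positive O
  O>0 = ℚ.normalize-pos o 1
  5/4*O≤a : (+ 5 / 4) ℚ.* O ℚ.≤ + a / 1
  -- Reducing to lowest terms is stuck on variable numerators; unnormalised fractions allow
  -- cross-multiplication.
  5/4*O≤a = ℚ.toℚᵘ-cancel-≤ (ℚᵘ.≤-respˡ-≃ (ℚᵘ.≃-sym 5/4*O≃)
    (ℚᵘ.≤-respʳ-≃ (ℚᵘ.≃-sym (ℚ.toℚᵘ-fromℚᵘ (+ a ℚᵘ./ 1))) (ℚᵘ.*≤* 5o*1≤a*4)))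
    where
    5/4*O≃ : ℚ.toℚᵘ ((+ 5 / 4) ℚ.* O) ℚᵘ.≃ (+ 5 ℚᵘ./ 4) ℚᵘ.* (+ o ℚᵘ./ 1)
    5/4*O≃ = ℚᵘ.≃-trans (ℚ.toℚᵘ-homo-* (+ 5 / 4) O)
      (ℚᵘ.*-congˡ {+ 5 ℚᵘ./ 4} (ℚ.toℚᵘ-fromℚᵘ (+ o ℚᵘ./ 1)))
    5o*1≤a*4 : + 5 ℤ.* + o ℤ.* + 1 ℤ.≤ + a ℤ.* + 4
    5o*1≤a*4 = subst₂ ℤ._≤_
      (trans (ℤ.pos-* 5 o) (sym (ℤ.*-identityʳ _)))
      (trans (cong +_ (ℕ.*-comm 4 a)) (ℤ.pos-* a 4)) (+≤+ 5o≤4a)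

-- Two weight scenarios and the adversary game

open Graph (grid 2 4)
open DecMembership _≟_ using (_∈?_)

Scenario : Set
Scenario = Fin 2

heavy : Scenario → Edge → Bool
heavy _  (horizontal 0F 0F) = true
heavy _  (horizontal 1F 2F) = true
heavy 0F (horizontal 0F 1F) = true
heavy 1F (vertical 0F 2F)   = true
heavy _  _                  = false

price : ℕ → Scenario → Edge → ℕ
price k s e = if heavy s e then k else 1

Incident : List Vertex → Edge → Set
Incident S e = let (u , v) = endpoints e in u ∈ S ⊎ v ∈ S

-- Comparing `heavy` instead of weights keeps `k` out of the game, so that it can be evaluated.
Agree : List Vertex → Scenario → Scenario → Set
Agree S s t = ∀ e → Incident S e → heavy s e ≡ heavy t e

Complete : List Vertex → Set
Complete S = ∀ u → u ∈ S

-- An agent at v that has visited S and seen the weights of scenario s there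
-- can be made to spend another n.  The scenario may be replaced at every move,
-- as long as nothing revealed so far changes.  The heavy weight k enters only
-- through its lower bound 5, and f bounds the number of moves.
Loses : ℕ → ℕ → Scenario → Vertex → List Vertex → Set
Loses zero    n s v S = n ≡ 0
Loses (suc f) n s v S = n ≡ 0 ⊎ ¬ Complete S ×
  (∀ w e → Joins e v w → ∃ λ t → Agree S s t × Loses f (n ∸ price 5 t e) t w (w ∷ S))

-- Deciding the game by finite search

∀-edge? : ∀ {P : Edge → Set} → (∀ e → Dec (P e)) → Dec (∀ e → P e)
∀-edge? P? = map′ (λ ps e → All.lookup ps (complete e)) (λ p → All.universal p edges)
  (All.all? P? edges)

-- An edge and its orientation determine `w`, so searching the edges in both orientations suffices.
∀-move? : ∀ {P : Vertex → Edge → Set} → (∀ w e → Dec (P w e)) →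
          ∀ v → Dec (∀ w e → Joins e v w → P w e)
∀-move? {P} P? v = map′ to from (∀-edge? λ e → let (a , b) = endpoints e in
  ((v ≟ a) →-dec P? b e) ×-dec ((v ≟ b) →-dec P? a e))
  where
  Ends : Edge → Set
  Ends e = let (a , b) = endpoints e in (v ≡ a → P b e) × (v ≡ b → P a e)
  to : (∀ e → Ends e) → ∀ w e → Joins e v w → P w e
  to f w e (inj₁ e≡) = subst (λ b → P b e) (cong proj₂ e≡) (proj₁ (f e) (sym (cong proj₁ e≡)))
  to f w e (inj₂ e≡) = subst (λ a → P a e) (cong proj₁ e≡) (proj₂ (f e) (sym (cong proj₂ e≡)))
  from : (∀ w e → Joins e v w → P w e) → ∀ e → Ends e
  from g e = (λ { refl → g _ e (inj₁ refl) }) , (λ { refl → g _ e (inj₂ refl) })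

complete? : ∀ S → Dec (Complete S)
complete? S = map′ (λ p (i , j) → p i j) (λ p i j → p (i , j))
  (Fin.all? λ i → Fin.all? λ j → (i , j) ∈? S)

agree? : ∀ S s t → Dec (Agree S s t)
agree? S s t = ∀-edge? λ e → let (u , v) = endpoints e in
  ((u ∈? S) ⊎-dec (v ∈? S)) →-dec (heavy s e Bool.≟ heavy t e)

loses? : ∀ f n s v S → Dec (Loses f n s v S)
loses? zero    n s v S = n ℕ.≟ 0
loses? (suc f) n s v S = (n ℕ.≟ 0) ⊎-dec (¬? (complete? S) ×-dec
  ∀-move? (λ w e → Fin.any? λ t →
    agree? S s t ×-dec loses? f (n ∸ price 5 t e) t w (w ∷ S)) v)

-- Each move costs at least 1, so ten moves exhaust the budget and depth 10 suffices. The scenario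
-- `0F` is provisional: both look the same from the start.
agent-loses : Loses 10 10 0F (0F , 0F) ((0F , 0F) ∷ [])
agent-loses = from-yes (loses? 10 10 0F (0F , 0F) ((0F , 0F) ∷ []))

-- Tours of cost 8 in both scenarios

module Adversary (k : ℕ) (5≤k : 5 ≤ k) where

  open Exploration (grid 2 4) (zero , zero) (1 ∷ k ∷ [])

  weights : Scenario → WeightFunction
  weights s = price k s , admissible
    where
    admissible : ∀ e → price k s e ∈ 1 ∷ k ∷ []
    admissible e with heavy s e
    ... | true  = there (here refl)
    ... | false = here refl

  price-mono : ∀ s e → price 5 s e ≤ price k s e
  price-mono s e with heavy s e
  ... | true  = 5≤k
  ... | false = ℕ.≤-refl

  price-pos : ∀ s e → 1 ≤ price k s e
  price-pos s e with heavy s e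
  ... | true  = ℕ.≤-trans (s≤s z≤n) 5≤k
  ... | false = ℕ.≤-refl

  cost-pos : ∀ s {v} (p : Path v) → Explores p → 0 < cost (weights s) p
  cost-pos s start p-explores with p-explores (1F , 0F)
  ... | here ()
  ... | there ()
  cost-pos s (p ▸ (_ , e , _)) _ =
    ℕ.≤-trans (price-pos s e) (ℕ.m≤n+m _ (cost (weights s) p))

  Attains : Scenario → ℕ → Set
  Attains s m = ∃₂ λ v (p : Path v) → Explores p × cost (weights s) p ≡ m

  -- Each of the 7 light edges is used once, and the edge to the leaf once more for the way back.
  tour : ∀ s → Attains s 8
  tour 0F = _ , path , from-yes (complete? (visited path)) , refl
    where
    path =
      start
      ▸ ((1F , 0F) , vertical   0F 0F , inj₁ refl)
      ▸ ((1F , 1F) , horizontal 1F 0F , inj₁ refl)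
      ▸ ((0F , 1F) , vertical   0F 1F , inj₂ refl)
      ▸ ((1F , 1F) , vertical   0F 1F , inj₁ refl)
      ▸ ((1F , 2F) , horizontal 1F 1F , inj₁ refl)
      ▸ ((0F , 2F) , vertical   0F 2F , inj₂ refl)
      ▸ ((0F , 3F) , horizontal 0F 2F , inj₁ refl)
      ▸ ((1F , 3F) , vertical   0F 3F , inj₁ refl)
  tour 1F = _ , path , from-yes (complete? (visited path)) , refl
    where
    path =
      start
      ▸ ((1F , 0F) , vertical   0F 0F , inj₁ refl)
      ▸ ((1F , 1F) , horizontal 1F 0F , inj₁ refl)
      ▸ ((1F , 2F) , horizontal 1F 1F , inj₁ refl)
      ▸ ((1F , 1F) , horizontal 1F 1F , inj₂ refl)
      ▸ ((0F , 1F) , vertical   0F 1F , inj₂ refl)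
      ▸ ((0F , 2F) , horizontal 0F 1F , inj₁ refl)
      ▸ ((0F , 3F) , horizontal 0F 2F , inj₁ refl)
      ▸ ((1F , 3F) , vertical   0F 3F , inj₁ refl)

  -- Runs of an algorithm against the adversary

  module _ (alg : OnlineAlgorithm) where

    open OnlineAlgorithm alg renaming (strategy to σ)

    -- `Reaches` peels off the last move; this form exposes the first move after `p` on the way to
    -- `r`.
    data Leads (c : WeightFunction) {w} (r : Path w) : ∀ {v} → Path v → Set where
      arrived : Leads c r r
      move    : ∀ {v} {p : Path v} {m : Move v} →
                σ p (revealed c p) ≡ just m → Leads c r (p ▸ m) → Leads c r p

    leads-cost : ∀ {c w} {r : Path w} {v} {p : Path v} →
                 Leads c r p → cost c p ≤ cost c r
    leads-cost arrived      = ℕ.≤-refl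
    leads-cost (move _ p⇒r) = ℕ.≤-trans (ℕ.m≤m+n _ _) (leads-cost p⇒r)

    -- Determinism: the run to `r` is turned round to lead from `start`, then followed along `p`. At
    -- each prefix the strategy has only one answer, and it stops at `r`, so `p` cannot go past `r`.
    reaches⇒leads : ∀ {c w} {r : Path w} → Travels σ c r →
                    ∀ {v} {p : Path v} → Reaches σ c p → Leads c r p
    reaches⇒leads {c} {r = r} (r-reached , r-stops) = forward
      where
      from-start : ∀ {v} {p : Path v} → Reaches σ c p → Leads c r p → Leads c r start
      from-start start                 p⇒r = p⇒r
      from-start (step p-reached m≡) p⇒r = from-start p-reached (move m≡ p⇒r)

      follow : ∀ {v} {p : Path v} {m} → σ p (revealed c p) ≡ just m →
               Leads c r p → Leads c r (p ▸ m)
      follow m≡ arrived with () ← trans (sym m≡) r-stops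
      follow {p = p} m≡ (move m′≡ p⇒r) =
        subst (λ m → Leads c r (p ▸ m)) (just-injective (trans (sym m′≡) m≡)) p⇒r

      forward : ∀ {v} {p : Path v} → Reaches σ c p → Leads c r p
      forward start               = from-start r-reached arrived
      forward (step p-reached m≡) = follow m≡ (forward p-reached)

    agree⇒revealed : ∀ {s t v} (p : Path v) → Agree (visited p) s t →
                     revealed (weights s) p ≡ revealed (weights t) p
    agree⇒revealed {s} {t} p s~t = map-cong-local (All.tabulate λ {e} e∈ →
      cong (λ h → e , (if h then k else 1))
        (s~t e (proj₂ (∈-filter⁻ (λ e → let (u , v) = endpoints e in
          (u ∈? visited p) ⊎-dec (v ∈? visited p)) e∈))))

    -- Covering every `t` still indistinguishable from `s` lets the adversary switch later; `n` is
    -- what remains to be charged.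
    Consistent : ℕ → Scenario → ∀ {v} → Path v → Set
    Consistent n s p = ∀ t → Agree (visited p) s t →
      Reaches σ (weights t) p × 10 ≤ cost (weights t) p + n

    end-visited : ∀ {v} (p : Path v) → v ∈ visited p
    end-visited start   = here refl
    end-visited (_ ▸ _) = here refl

    incident : ∀ {v} (p : Path v) ((_ , e , _) : Move v) → Incident (visited p) e
    incident p (_ , e , inj₁ e≡) =
      inj₁ (subst (λ u → proj₁ u ∈ visited p) (sym e≡) (end-visited p))
    incident p (_ , e , inj₂ e≡) =
      inj₂ (subst (λ u → proj₂ u ∈ visited p) (sym e≡) (end-visited p))

    -- A scenario `u` agreeing with `t` after the move agrees with `s` before it, so the old
    -- invariant covers `u`, and equal revealed data force the same move.
    advance : ∀ {n s t v} {p : Path v} {m : Move v} → let (_ , e , _) = m in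
              Consistent n s p → σ p (revealed (weights s) p) ≡ just m →
              Agree (visited p) s t → Consistent (n ∸ price 5 t e) t (p ▸ m)
    advance {n} {s} {t} {p = p} {m@(_ , e , _)} consistent m≡ s~t u t~u =
      step (proj₁ (consistent u s~u)) (trans (cong (σ p) (sym (agree⇒revealed p s~u))) m≡) ,
      (begin
        10                                       ≤⟨ proj₂ (consistent u s~u) ⟩
        -- This also holds when the price exceeds `n` and the subtraction truncates to 0.
        C + n                                    ≤⟨ ℕ.+-monoʳ-≤ C (ℕ.m≤n+m∸n n (price 5 t e)) ⟩
        C + (price 5 t e + (n ∸ price 5 t e))    ≡⟨ ℕ.+-assoc C _ _ ⟨
        C + price 5 t e + (n ∸ price 5 t e)      ≤⟨ ℕ.+-monoˡ-≤ _ (ℕ.+-monoʳ-≤ C t≤u) ⟩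
        C + price k u e + (n ∸ price 5 t e)      ∎)
      where
      open ℕ.≤-Reasoning
      C = cost (weights u) p
      s~u : Agree (visited p) s u
      s~u e′ (inj₁ i) = trans (s~t e′ (inj₁ i)) (t~u e′ (inj₁ (there i)))
      s~u e′ (inj₂ i) = trans (s~t e′ (inj₂ i)) (t~u e′ (inj₂ (there i)))
      t≤u : price 5 t e ≤ price k u e
      -- The edge `e` leaves a visited vertex, so `s`, `t` and `u` already agree on it.
      t≤u = subst (λ h → (if h then 5 else 1) ≤ price k u e)
        (trans (sym (s~u e (incident p m))) (s~t e (incident p m))) (price-mono u e)

    Expensive : Set
    Expensive = ∃ λ s → 10 ≤ cost-alg alg (weights s)

    continue : ∀ {s v} {p : Path v} → Reaches σ (weights s) p →
               Leads (weights s) (proj₁ (proj₂ (solves (weights s)))) p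
    continue {s} = reaches⇒leads (proj₁ (proj₂ (proj₂ (solves (weights s)))))

    paid⇒expensive : ∀ {s v} (p : Path v) → Consistent 0 s p → Expensive
    paid⇒expensive {s} p consistent =
      let (p-reached , 10≤) = consistent s (λ _ _ → refl) in
      s , ℕ.≤-trans (subst (10 ≤_) (ℕ.+-identityʳ _) 10≤) (leads-cost (continue p-reached))

    -- The completed run under `weights s` passes through `p`. If `p` misses a vertex, the run
    -- cannot end there, and its next move is answered by a new scenario.
    loses⇒expensive : ∀ f n s {v} (p : Path v) → Loses f n s v (visited p) →
                      Consistent n s p → Expensive
    loses⇒expensive zero    n s p refl        consistent = paid⇒expensive p consistent
    loses⇒expensive (suc f) n s p (inj₁ refl) consistent = paid⇒expensive p consistent
    loses⇒expensive (suc f) n s p (inj₂ (incomplete , next)) consistent =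
      case (continue (proj₁ (consistent s λ _ _ → refl)))
      where
      case : Leads (weights s) (proj₁ (proj₂ (solves (weights s)))) p → Expensive
      case arrived = contradiction (proj₂ (proj₂ (proj₂ (solves (weights s))))) incomplete
      case (move {m = m@(w , e , joins)} m≡ _) =
        let (t , s~t , loses) = next w e joins
        in loses⇒expensive f _ t (p ▸ m) loses (advance consistent m≡ s~t)

    expensive : Expensive
    expensive = loses⇒expensive 10 10 0F start agent-loses
      (λ _ _ → start , ℕ.≤-refl)

-- Constructively an optimal cost exists only up to double negation, which the
-- bound on r absorbs.
theorem1 : (k : ℕ) → 5 ≤ k →
    let open Exploration (grid 2 4) (zero , zero) (1 ∷ k ∷ []) in
    (alg : OnlineAlgorithm) (r : ℝ) →
    StrictlyCompetitive alg r → fromℚ (+ 5 / 4) ≤ʳ r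
theorem1 k 5≤k alg r competitive = fromℚ-≤ʳ-stable (+ 5 / 4) r λ unbounded →
  let (s , 10≤alg) = expensive alg in
  ¬¬-least {Attains s} 8 (tour s) λ { (m , optimum@(_ , p , p-explores , refl) , least) →
    unbounded (ratio-bound (cost-alg alg (weights s)) m r (cost-pos s p p-explores)
      -- The two bounds meet at 5 * 8 = 40 = 4 * 10.
      (ℕ.≤-trans (ℕ.*-monoʳ-≤ 5 (least 8 (tour s))) (ℕ.*-monoʳ-≤ 4 10≤alg))
      (competitive (weights s) m
        (optimum , λ q q-explores → least _ (_ , q , q-explores , refl)))) }
  where
  open Adversary k 5≤k
  open Exploration (grid 2 4) (zero , zero) (1 ∷ k ∷ [])
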